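{- Let $\mathcal L$ be a finite modular complemented lattice. Let $\mathcal Z\subseteq\mathcal L$ be a lattice for the inherited order, with meet $\wedge_{\mathcal Z}$, join $\vee_{\mathcal Z}$ and least element $0_{\mathcal Z}$. Let $\lambda:\mathcal Z\to\mathbb R_{\ge0}$ and $f:\mathcal A(\mathcal L)\to\mathbb R_{\ge0}$. If $(\mathcal Z,\lambda,f)$ satisfies (Z1), (Z2) and (Z5), then $(\mathcal L,\rho_{(\lambda,f)})$ is an $\mathcal L$-polymatroid.
   Context: $\mathcal L$ has least element $\mathbf 0$, greatest element $\mathbf 1$ and height function $\mathrm h$. $\mathcal A(X)$ is the set of atoms below $X$. Complements: $\mathbf C(A)=\{C:C\wedge A=\mathbf 0,C\vee A=\mathbf 1\}$ and $\mathbf C(A;B)=\{A^c\in\mathbf C(A):(A^c\wedge B)\vee(A\wedge B)=B\}$. $\mu_f(\mathbf 0)=0$, and $\mu_f(A)=\min\{\sum_{x\in\beta}f(x):\beta\subseteq\mathcal A(A),|\beta|=\mathrm h(A),\bigvee\beta=A\}$ otherwise. $g$ is quasi-modular on $[\mathbf 0,X]$ if for every $Y\le X$ there is $Y^c\in\mathbf C(Y)$ with $g(X)=g(Y)+g(X\wedge Y^c)$. $\rho_{(\lambda,f)}(X)=\min\{\lambda(Z)+\mu_f(X\wedge Z^c):Z\in\mathcal Z,Z^c\in\mathbf C(Z;X)\}$, and $\mathcal Z(X)$ is the set of $Z$ attaining this minimum for some $Z^c\in\mathbf C(Z;X)$. Axioms: - (Z1) For every $X$ there is $Z\in\mathcal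 Z(X)$ such that (i) $\lambda(Z)+\mu_f(X\wedge Z^c)=\rho_{(\lambda,f)}(X)$ for every $Z^c\in\mathbf C(Z;X)$, and (ii) $\mu_f$ is quasi-modular on $[\mathbf 0,X\wedge Z^c]$ for every $Z^c\in\mathbf C(Z;X)$. - (Z2) For all $Z_1,Z_2\in\mathcal Z$, all $(Z_1\wedge_{\mathcal Z}Z_2)^c\in\mathbf C(Z_1\wedge_{\mathcal Z}Z_2)$ and all $A\in\mathcal L$: $\lambda(Z_1)+\lambda(Z_2)\ge\lambda(Z_1\wedge_{\mathcal Z}Z_2)+\lambda(Z_1\vee_{\mathcal Z}Z_2)+\mu_f(A\wedge Z_1\wedge Z_2\wedge(Z_1\wedge_{\mathcal Z}Z_2)^c)$. - (Z5) $\lambda(0_{\mathcal Z})=0$. An $\mathcal L$-polymatroid is a pair $(\mathcal L,r)$ with $r:\mathcal L\to\mathbb R$ such that, for some $t\ge0$, $0\le r(A)\le t\,\mathrm h(A)$, $r$ is increasing, and $r(A)-r(A\wedge B)\ge r(A\vee B)-r(B)$ for all $A,B$. -}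

module Defs where

open import Level using (0ℓ)
open import Data.Nat as ℕ using (ℕ; zero; suc)
open import Data.Product using (Σ; ∃; ∃-syntax; _×_; _,_)
open import Data.Sum using (_⊎_)
open import Data.List using (List; []; _∷_; length; foldr; map)
open import Data.List.Membership.Propositional using (_∈_)
open import Data.List.Relation.Unary.All using (All)
open import Data.List.Relation.Unary.Unique.Propositional using (Unique)
open import Relation.Nullary using (¬_)
open import Relation.Binary.PropositionalEquality using (_≡_; _≢_)
open import Relation.Binary.Structures using (IsTotalOrder)
open import Algebra.Structures using (IsAbelianGroup)
open import Relation.Binary.Lattice.Structures using (IsBoundedLattice)

record FiniteModularComplementedLattice : Set₁ where
  field
    Carrier : Set
    _≤_ : Carrier → Carrier → Set
    _∨_ : Carrier → Carrier → Carrier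
    _∧_ : Carrier → Carrier → Carrier
    𝟏 : Carrier
    𝟎 : Carrier
    isBoundedLattice : IsBoundedLattice _≡_ _≤_ _∨_ _∧_ 𝟏 𝟎
    elements : List Carrier
    complete : ∀ x → x ∈ elements
    modular : ∀ a b c → a ≤ c → (a ∨ (b ∧ c)) ≡ ((a ∨ b) ∧ c)
    complemented : ∀ a → ∃[ c ] ((c ∧ a) ≡ 𝟎 × (c ∨ a) ≡ 𝟏)

-- Totally ordered abelian groups (the value domain; ℝ is an instance)

record OrderedAbelianGroup : Set₁ where
  field
    Carrier : Set
    _+_ : Carrier → Carrier → Carrier
    0# : Carrier
    -_ : Carrier → Carrier
    _≤_ : Carrier → Carrier → Set
    isAbelianGroup : IsAbelianGroup _≡_ _+_ 0# -_
    isTotalOrder : IsTotalOrder _≡_ _≤_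
    +-mono-≤ : ∀ a b c → a ≤ b → (a + c) ≤ (b + c)

  _-_ : Carrier → Carrier → Carrier
  a - b = a + (- b)

  _·_ : ℕ → Carrier → Carrier
  zero · a = 0#
  suc n · a = a + (n · a)

  infixl 6 _+_ _-_

module Setting (L : FiniteModularComplementedLattice) (V : OrderedAbelianGroup) where
  open FiniteModularComplementedLattice L
    renaming (Carrier to El; _≤_ to _⊑_)
  open OrderedAbelianGroup V
    renaming (Carrier to ℝ; _≤_ to _≤ᵥ_)

  _⊏_ : El → El → Set
  a ⊏ b = a ⊑ b × a ≢ b

  data Chain : El → El → ℕ → Set where
    done : ∀ {a} → Chain a a 0
    step : ∀ {a b c n} → a ⊏ b → Chain b c n → Chain a c (suc n)

  IsHeight : El → ℕ → Set
  IsHeight X k = Chain 𝟎 X k × (∀ n → Chain 𝟎 X n → n ℕ.≤ k)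

  IsHeightFunction : (El → ℕ) → Set
  IsHeightFunction h = ∀ X → IsHeight X (h X)

  IsAtom : El → Set
  IsAtom x = 𝟎 ⊏ x × (∀ y → y ⊑ x → y ≡ 𝟎 ⊎ y ≡ x)

  IsMin : (ℝ → Set) → ℝ → Set
  IsMin P v = P v × (∀ w → P w → v ≤ᵥ w)

  ⋁ : List El → El
  ⋁ = foldr _∨_ 𝟎

  Σf : (El → ℝ) → List El → ℝ
  Σf f β = foldr _+_ 0# (map f β)

  BasisSum : (El → ℕ) → (El → ℝ) → El → ℝ → Set
  BasisSum h f A w =
    ∃[ β ] (Unique β × All (λ x → IsAtom x × x ⊑ A) β
            × length β ≡ h A × ⋁ β ≡ A × Σf f β ≡ w)

  IsMuF : (El → ℕ) → (El → ℝ) → (El → ℝ) → Set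
  IsMuF h f μ = μ 𝟎 ≡ 0# × (∀ A → A ≢ 𝟎 → IsMin (BasisSum h f A) (μ A))

  Compl : El → El → Set
  Compl A C = (C ∧ A) ≡ 𝟎 × (C ∨ A) ≡ 𝟏

  ComplRel : El → El → El → Set
  ComplRel A B C = Compl A C × ((C ∧ B) ∨ (A ∧ B)) ≡ B

  QuasiModularOn : (El → ℝ) → El → Set
  QuasiModularOn g X = ∀ Y → Y ⊑ X → ∃[ C ] (Compl Y C × g X ≡ g Y + g (X ∧ C))

  -- 𝒵 ⊆ L, a lattice for the inherited order, given by an injection ι
  record SubLattice : Set₁ where
    field
      Z : Set
      ι : Z → El
      ι-injective : ∀ a b → ι a ≡ ι b → a ≡ b
      _∧Z_ : Z → Z → Z
      _∨Z_ : Z → Z → Z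
      0Z : Z
      ∧Z-lower₁ : ∀ a b → ι (a ∧Z b) ⊑ ι a
      ∧Z-lower₂ : ∀ a b → ι (a ∧Z b) ⊑ ι b
      ∧Z-greatest : ∀ a b c → ι c ⊑ ι a → ι c ⊑ ι b → ι c ⊑ ι (a ∧Z b)
      ∨Z-upper₁ : ∀ a b → ι a ⊑ ι (a ∨Z b)
      ∨Z-upper₂ : ∀ a b → ι b ⊑ ι (a ∨Z b)
      ∨Z-least : ∀ a b c → ι a ⊑ ι c → ι b ⊑ ι c → ι (a ∨Z b) ⊑ ι c
      0Z-least : ∀ a → ι 0Z ⊑ ι a

  module _ (𝒵 : SubLattice) (h : El → ℕ) (μ : El → ℝ)
           (λ' : SubLattice.Z 𝒵 → ℝ) where
    open SubLattice 𝒵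

    RhoCandidate : El → ℝ → Set
    RhoCandidate X w = ∃[ z ] ∃[ C ] (ComplRel (ι z) X C × λ' z + μ (X ∧ C) ≡ w)

    IsRho : (El → ℝ) → Set
    IsRho ρ = ∀ X → IsMin (RhoCandidate X) (ρ X)

    InZX : (El → ℝ) → El → Z → Set
    InZX ρ X z = ∃[ C ] (ComplRel (ι z) X C × λ' z + μ (X ∧ C) ≡ ρ X)

    Z1 : (El → ℝ) → Set
    Z1 ρ = ∀ X → ∃[ z ] (InZX ρ X z
            × (∀ C → ComplRel (ι z) X C → λ' z + μ (X ∧ C) ≡ ρ X)
            × (∀ C → ComplRel (ι z) X C → QuasiModularOn μ (X ∧ C)))

    Z2 : Set
    Z2 = ∀ z₁ z₂ C → Compl (ι (z₁ ∧Z z₂)) C → ∀ A →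
           (λ' (z₁ ∧Z z₂) + λ' (z₁ ∨Z z₂) + μ (((A ∧ ι z₁) ∧ ι z₂) ∧ C))
             ≤ᵥ (λ' z₁ + λ' z₂)

    Z5 : Set
    Z5 = λ' 0Z ≡ 0#

  IsPolymatroid : (El → ℕ) → (El → ℝ) → Set
  IsPolymatroid h r =
    ∃[ t ] (0# ≤ᵥ t
           × (∀ A → 0# ≤ᵥ r A × r A ≤ᵥ (h A · t))
           × (∀ A B → A ⊑ B → r A ≤ᵥ r B)
           × (∀ A B → (r (A ∨ B) - r B) ≤ᵥ (r A - r (A ∧ B))))

{-# OPTIONS --safe #-}
-- A minimising Z^c enters only through D = X ∧ Z^c, and these D are exactly the
-- relative complements of Z ∧ X in [𝟎 , X].  Greedily thinning out a union of
-- minimum bases shows that if K together with Y₁ , … , Yₙ joins to X, then some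
-- relative complement of K in X has μ at most Σ μ(Yᵢ).
--
-- For submodularity let u, v ∈ 𝒵 be given by (Z1) for A and B.  Split A ∧ B by
-- complements Q₁, Q₂, P along A ∧ B ≥ A ∧ B ∧ u ≥ A ∧ B ∧ u ∧ v ≥ A ∧ B ∧ (u ∧_𝒵 v).
-- Then Q₁ misses u and Q₂ misses v, so they extend to admissible D₁ for A and D₂
-- for B; quasi-modularity gives μ(Dᵢ) = μ(Qᵢ) + μ(Rᵢ).  Now Q₁, Q₂, P bound ρ(A ∧ B),
-- R₁, R₂ bound ρ(A ∨ B) since Q₂ ≤ u and Q₁ ≤ B, and (Z2) absorbs μ(P).
module Submission where

open import Defs
open import Algebra.Bundles using (AbelianGroup)
open import Data.Empty using (⊥-elim)
open import Data.List using (List; []; _∷_; _++_; length)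
open import Data.List.Membership.Propositional using (_∈_)
open import Data.List.Relation.Unary.All as All using (All; []; _∷_)
open import Data.List.Relation.Unary.All.Properties using (++⁺)
open import Data.List.Relation.Unary.AllPairs using ([]; _∷_)
open import Data.List.Relation.Unary.Any using (here; there)
open import Data.List.Relation.Unary.Unique.Propositional using (Unique)
open import Data.Nat as ℕ using (ℕ; zero; suc; z≤n)
open import Data.Nat.Properties as ℕₚ using ()
open import Data.Product using (∃-syntax; _×_; _,_; proj₁; proj₂)
open import Data.Sum using (_⊎_; inj₁; inj₂)
open import Function using (_∘_)
open import Relation.Binary.Lattice.Structures using (IsBoundedLattice)
open import Relation.Binary.PropositionalEquality
open import Relation.Binary.Structures using (IsTotalOrder)
open import Relation.Nullary using (¬_; Dec; yes; no)
import Algebra.Solver.CommutativeMonoid as CommutativeMonoidSolver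

-- Relative complements in a modular complemented lattice.

module LatticeFacts (L : FiniteModularComplementedLattice) where
  open FiniteModularComplementedLattice L
    renaming (Carrier to El; _≤_ to infix 4 _⊑_; _∧_ to infix 7 _∧_; _∨_ to infix 6 _∨_)
  open IsBoundedLattice isBoundedLattice public
    using (x≤x∨y; y≤x∨y; ∨-least; x∧y≤x; x∧y≤y; ∧-greatest; maximum; minimum)
    renaming (refl to ⊑-refl; trans to ⊑-trans; antisym to ⊑-antisym; reflexive to ⊑-reflexive)

  ⊑𝟎⇒≡𝟎 : ∀ {a} → a ⊑ 𝟎 → a ≡ 𝟎
  ⊑𝟎⇒≡𝟎 a⊑𝟎 = ⊑-antisym a⊑𝟎 (minimum _)

  ∧≡𝟎-mono : ∀ {a b c d} → a ⊑ c → b ⊑ d → c ∧ d ≡ 𝟎 → a ∧ b ≡ 𝟎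
  ∧≡𝟎-mono {a} {b} a⊑c b⊑d c∧d≡𝟎 = ⊑𝟎⇒≡𝟎 (⊑-trans
    (∧-greatest (⊑-trans (x∧y≤x a b) a⊑c) (⊑-trans (x∧y≤y a b) b⊑d))
    (⊑-reflexive c∧d≡𝟎))

  -- By modularity `(b ∨ a) ∧ (b ∨ c)` is `b ∨ (a ∧ (b ∨ c))`, which collapses to `b`; so the meet
  -- in question lies below `b ∧ c`.
  ∨∧≡𝟎 : ∀ a b c → b ∧ c ≡ 𝟎 → a ∧ (b ∨ c) ≡ 𝟎 → (a ∨ b) ∧ c ≡ 𝟎
  ∨∧≡𝟎 a b c b∧c≡𝟎 a∧[b∨c]≡𝟎 = ⊑𝟎⇒≡𝟎 (⊑-trans
    (∧-greatest ⊑b (x∧y≤y _ c)) (⊑-reflexive b∧c≡𝟎))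
    where
    ⊑b : (a ∨ b) ∧ c ⊑ b
    ⊑b = ⊑-trans
      (∧-greatest
        (⊑-trans (x∧y≤x _ c) (∨-least (y≤x∨y b a) (x≤x∨y b a)))
        (⊑-trans (x∧y≤y _ c) (y≤x∨y b c)))
      (⊑-trans (⊑-reflexive (sym (modular b a (b ∨ c) (x≤x∨y b c))))
        (∨-least ⊑-refl (⊑-trans (⊑-reflexive a∧[b∨c]≡𝟎) (minimum b))))

  RelCompl : El → El → El → Set
  RelCompl K X D = D ∧ K ≡ 𝟎 × D ∨ K ≡ X

  RelCompl-⊑ : ∀ {K X D} → RelCompl K X D → D ⊑ X
  RelCompl-⊑ {K} (_ , D∨K≡X) = ⊑-trans (x≤x∨y _ K) (⊑-reflexive D∨K≡X)

  -- Cut a complement `E` of `D ∨ K` down to `X` and put `D′ = (E ∧ X) ∨ D`. Modularity makes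
  -- `E ∧ X` and `D ∨ K` span `X`, and `∨∧≡𝟎` keeps `D′` off `K`.
  extend : ∀ {K X D} → D ⊑ X → K ⊑ X → D ∧ K ≡ 𝟎 → ∃[ D′ ] (D ⊑ D′ × RelCompl K X D′)
  extend {K} {X} {D} D⊑X K⊑X D∧K≡𝟎 with complemented (D ∨ K)
  ... | E , E∧[D∨K]≡𝟎 , E∨[D∨K]≡𝟏 =
    (E ∧ X) ∨ D , y≤x∨y _ D ,
    ∨∧≡𝟎 (E ∧ X) D K D∧K≡𝟎 (∧≡𝟎-mono (x∧y≤x E X) ⊑-refl E∧[D∨K]≡𝟎) ,
    ⊑-antisym (∨-least (∨-least (x∧y≤y E X) D⊑X) K⊑X) X⊑
    where
    X⊑ : X ⊑ ((E ∧ X) ∨ D) ∨ K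
    X⊑ = ⊑-trans
      (∧-greatest
        (⊑-trans (maximum X) (⊑-trans (⊑-reflexive (sym E∨[D∨K]≡𝟏))
          (∨-least (y≤x∨y _ E) (x≤x∨y _ E))))
        ⊑-refl)
      (⊑-trans (⊑-reflexive (sym (modular (D ∨ K) E X (∨-least D⊑X K⊑X))))
        (∨-least
          (∨-least (⊑-trans (y≤x∨y _ D) (x≤x∨y _ K)) (y≤x∨y _ K))
          (⊑-trans (x≤x∨y _ D) (x≤x∨y _ K))))

  relCompl : ∀ {K X} → K ⊑ X → ∃[ D ] RelCompl K X D
  relCompl {K} K⊑X with extend (minimum _) K⊑X (⊑𝟎⇒≡𝟎 (x∧y≤x 𝟎 K))
  ... | D , _ , D-compl = D , D-compl

-- Chains, atoms and the height function.

module Heights (L : FiniteModularComplementedLattice) (V : OrderedAbelianGroup)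
    (h : FiniteModularComplementedLattice.Carrier L → ℕ)
    (isHeight : Setting.IsHeightFunction L V h) where
  open FiniteModularComplementedLattice L
    renaming (Carrier to El; _≤_ to infix 4 _⊑_; _∧_ to infix 7 _∧_; _∨_ to infix 6 _∨_)
  open Setting L V
  open LatticeFacts L

  ⊑-⊏-trans : ∀ {a b c} → a ⊑ b → b ⊏ c → a ⊏ c
  ⊑-⊏-trans a⊑b (b⊑c , b≢c) =
    ⊑-trans a⊑b b⊑c , λ { refl → b≢c (⊑-antisym b⊑c a⊑b) }

  ⊏-⊑-trans : ∀ {a b c} → a ⊏ b → b ⊑ c → a ⊏ c
  ⊏-⊑-trans (a⊑b , a≢b) b⊑c =
    ⊑-trans a⊑b b⊑c , λ { refl → a≢b (⊑-antisym a⊑b b⊑c) }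

  Chain-⊑ : ∀ {a b n} → Chain a b n → a ⊑ b
  Chain-⊑ done = ⊑-refl
  Chain-⊑ (step (a⊑b , _) c) = ⊑-trans a⊑b (Chain-⊑ c)

  _++ᶜ_ : ∀ {a b c m n} → Chain a b m → Chain b c n → Chain a c (m ℕ.+ n)
  done ++ᶜ d = d
  step a⊏b c ++ᶜ d = step a⊏b (c ++ᶜ d)

  -- Stretching the last step keeps it strict, so there is no need to decide whether `b` equals `c`.
  raise-top : ∀ {a b c n} → Chain a b (suc n) → b ⊑ c → Chain a c (suc n)
  raise-top (step a⊏b done) b⊑c = step (⊏-⊑-trans a⊏b b⊑c) done
  raise-top (step a⊏b c@(step _ _)) b⊑c = step a⊏b (raise-top c b⊑c)

  chain≤h : ∀ {a X k} → Chain 𝟎 a k → a ⊑ X → k ℕ.≤ h X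
  chain≤h {k = zero} _ _ = z≤n
  chain≤h {X = X} {k = suc k} c a⊑X = proj₂ (isHeight X) (suc k) (raise-top c a⊑X)

  -- The gap from `a` to `b` may or may not be strict. It is absorbed into the first step of the
  -- second chain or, if that chain is empty, by raising the top of the first.
  chain-⊑-chain≤h : ∀ {a b X k n} → Chain 𝟎 a k → a ⊑ b → Chain b X n → k ℕ.+ n ℕ.≤ h X
  chain-⊑-chain≤h {X = X} {k = k} c a⊑b done =
    subst (ℕ._≤ h X) (sym (ℕₚ.+-identityʳ k)) (chain≤h c a⊑b)
  chain-⊑-chain≤h c a⊑b (step s d) =
    chain≤h (c ++ᶜ step (⊑-⊏-trans a⊑b s) d) ⊑-refl

  -- No decidable equality is assumed on the lattice; the height function supplies this case.
  ≡𝟎? : ∀ X → Dec (X ≡ 𝟎)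
  ≡𝟎? X with h X | isHeight X
  ... | zero | done , _ = yes refl
  ... | suc _ | step (𝟎⊑b , 𝟎≢b) c , _ =
    no λ { refl → 𝟎≢b (⊑-antisym 𝟎⊑b (Chain-⊑ c)) }

  h-𝟎 : h 𝟎 ≡ 0
  h-𝟎 with h 𝟎 | isHeight 𝟎
  ... | zero | _ = refl
  ... | suc _ | step (𝟎⊑b , 𝟎≢b) c , _ = ⊥-elim (𝟎≢b (⊑-antisym 𝟎⊑b (Chain-⊑ c)))

  atom-∧ : ∀ {x} → IsAtom x → ∀ y → (x ∧ y ≡ 𝟎) ⊎ (x ⊑ y)
  atom-∧ {x} (_ , below) y with below (x ∧ y) (x∧y≤x x y)
  ... | inj₁ x∧y≡𝟎 = inj₁ x∧y≡𝟎
  ... | inj₂ x∧y≡x = inj₂ (⊑-trans (⊑-reflexive (sym x∧y≡x)) (x∧y≤y x y))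

  atom-disjoint⇒⋢ : ∀ {x y} → IsAtom x → x ∧ y ≡ 𝟎 → ¬ (x ⊑ y)
  atom-disjoint⇒⋢ ((_ , 𝟎≢x) , _) x∧y≡𝟎 x⊑y =
    𝟎≢x (sym (⊑𝟎⇒≡𝟎 (⊑-trans (∧-greatest ⊑-refl x⊑y) (⊑-reflexive x∧y≡𝟎))))

  module _ {x E : El} (x-atom : IsAtom x) (x∧E≡𝟎 : x ∧ E ≡ 𝟎) where

    -- The atom lies below `b ∨ E` or misses it. If it misses it, then `(E ∨ x) ∧ (b ∨ E) = E ∨ (x ∧
    -- (b ∨ E)) = E` by modularity, and `b` is below the left side.
    cover : ∀ {b} → b ⊑ x ∨ E → (b ⊑ E) ⊎ (x ∨ E ⊑ b ∨ E)
    cover {b} b⊑ with atom-∧ x-atom (b ∨ E)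
    ... | inj₂ x⊑ = inj₂ (∨-least x⊑ (y≤x∨y b E))
    ... | inj₁ disjoint = inj₁ (⊑-trans
      (∧-greatest (⊑-trans b⊑ (∨-least (y≤x∨y E x) (x≤x∨y E x))) (x≤x∨y b E))
      (⊑-trans (⊑-reflexive (sym (modular E x (b ∨ E) (y≤x∨y b E))))
        (∨-least ⊑-refl (⊑-trans (⊑-reflexive disjoint) (minimum E)))))

    -- Above b the join with E is constant, so by modularity the meet with E
    -- grows strictly along the chain.
    trace : ∀ {b n} → x ∨ E ⊑ b ∨ E → Chain b (x ∨ E) n → Chain (b ∧ E) E n
    trace _ done = subst (λ y → Chain ((x ∨ E) ∧ E) y 0)
      (⊑-antisym (x∧y≤y _ E) (∧-greatest (y≤x∨y x E) ⊑-refl)) done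
    trace {b} top (step {b = c} (b⊑c , b≢c) chain) =
      step (mono , λ eq → b≢c (⊑-antisym b⊑c (c⊑b eq)))
        (trace (⊑-trans top (∨-least (⊑-trans b⊑c (x≤x∨y c E)) (y≤x∨y c E))) chain)
      where
      mono : b ∧ E ⊑ c ∧ E
      mono = ∧-greatest (⊑-trans (x∧y≤x b E) b⊑c) (x∧y≤y b E)
      c⊑b : b ∧ E ≡ c ∧ E → c ⊑ b
      c⊑b eq = ⊑-trans (∧-greatest (⊑-trans (Chain-⊑ chain) top) ⊑-refl)
        (⊑-trans (⊑-reflexive (sym (modular b E c b⊑c)))
          (∨-least ⊑-refl (⊑-trans
            (∧-greatest (x∧y≤y E c) (x∧y≤x E c))
            (⊑-trans (⊑-reflexive (sym eq)) (x∧y≤x b E)))))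

    -- The chain stays below `E` until one step leaves it; from there on `trace` maps the rest into
    -- `E` at full length. Only the crossing step is lost, whence the `suc`.
    chain≤1+h : ∀ {a k n} → a ⊑ E → Chain 𝟎 a k → Chain a (x ∨ E) n →
                k ℕ.+ n ℕ.≤ suc (h E)
    chain≤1+h {k = k} a⊑E c done = subst (ℕ._≤ suc (h E)) (sym (ℕₚ.+-identityʳ k))
      (ℕₚ.m≤n⇒m≤1+n (chain≤h c a⊑E))
    chain≤1+h {k = k} a⊑E c (step {b = b} {n = n} a⊏b d) with cover (Chain-⊑ d)
    ... | inj₁ b⊑E = subst (ℕ._≤ suc (h E)) (ℕₚ.+-assoc k 1 n)
      (chain≤1+h b⊑E (c ++ᶜ step a⊏b done) d)
    ... | inj₂ top = subst (ℕ._≤ suc (h E)) (sym (ℕₚ.+-suc k n))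
      (ℕ.s≤s (chain-⊑-chain≤h c (∧-greatest (proj₁ a⊏b) a⊑E) (trace top d)))

    h-atom-∨ : h (x ∨ E) ≡ suc (h E)
    h-atom-∨ = ℕₚ.≤-antisym
      (chain≤1+h (minimum E) done (proj₁ (isHeight (x ∨ E))))
      (subst (ℕ._≤ h (x ∨ E)) (ℕₚ.+-comm (h E) 1)
        (chain≤h (proj₁ (isHeight E) ++ᶜ step (y≤x∨y x E , E≢) done) ⊑-refl))
      where
      E≢ : E ≢ x ∨ E
      E≢ eq = atom-disjoint⇒⋢ x-atom x∧E≡𝟎 (⊑-trans (x≤x∨y x E) (⊑-reflexive (sym eq)))

-- Inequalities in a totally ordered abelian group.

module OrderedGroupFacts (V : OrderedAbelianGroup) where
  open OrderedAbelianGroup V renaming (Carrier to ℝ; _≤_ to infix 4 _≤ᵥ_)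
  open IsTotalOrder isTotalOrder public
    using (total)
    renaming (refl to ≤ᵥ-refl; trans to ≤ᵥ-trans; reflexive to ≤ᵥ-reflexive)

  abelianGroup : AbelianGroup _ _
  abelianGroup = record { isAbelianGroup = isAbelianGroup }

  open AbelianGroup abelianGroup public
    using (commutativeMonoid) renaming
    ( comm to +-comm; assoc to +-assoc; identityʳ to +-identityʳ
    ; identityˡ to +-identityˡ; inverseʳ to +-inverseʳ )

  open CommutativeMonoidSolver commutativeMonoid public using (solve; _⊜_; _⊕_; id)

  +-mono : ∀ {a b c d} → a ≤ᵥ b → c ≤ᵥ d → (a + c) ≤ᵥ (b + d)
  +-mono {a} {b} {c} {d} a≤b c≤d = ≤ᵥ-trans (+-mono-≤ a b c a≤b)
    (subst₂ _≤ᵥ_ (+-comm c b) (+-comm d b) (+-mono-≤ c d b c≤d))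

  ≤-+ʳ : ∀ {a b} → 0# ≤ᵥ b → a ≤ᵥ (a + b)
  ≤-+ʳ {a} {b} 0≤b = subst (_≤ᵥ a + b) (+-identityʳ a) (+-mono ≤ᵥ-refl 0≤b)

  ≤-+ˡ : ∀ {a b} → 0# ≤ᵥ b → a ≤ᵥ (b + a)
  ≤-+ˡ {a} {b} 0≤b = subst (_≤ᵥ b + a) (+-identityˡ a) (+-mono 0≤b ≤ᵥ-refl)

  +-nonneg : ∀ {a b} → 0# ≤ᵥ a → 0# ≤ᵥ b → 0# ≤ᵥ (a + b)
  +-nonneg 0≤a 0≤b = ≤ᵥ-trans 0≤a (≤-+ʳ 0≤b)

  +≤+⇒-≤- : ∀ a b c d → (a + d) ≤ᵥ (c + b) → (a - b) ≤ᵥ (c - d)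
  +≤+⇒-≤- a b c d ad≤cb = subst₂ _≤ᵥ_ left right
    (+-mono-≤ (a + d) (c + b) ((- b) + (- d)) ad≤cb)
    where
    left : (a + d) + ((- b) + (- d)) ≡ a - b
    left = trans
      (solve 4 (λ w x y z → (w ⊕ x) ⊕ (y ⊕ z) ⊜ (w ⊕ y) ⊕ (x ⊕ z)) refl a d (- b) (- d))
      (trans (cong ((a - b) +_) (+-inverseʳ d)) (+-identityʳ _))
    right : (c + b) + ((- b) + (- d)) ≡ c - d
    right = trans
      (solve 4 (λ w x y z → (w ⊕ x) ⊕ (y ⊕ z) ⊜ (w ⊕ z) ⊕ (x ⊕ y)) refl c b (- b) (- d))
      (trans (cong ((c - d) +_) (+-inverseʳ b)) (+-identityʳ _))

  -- Supplies the constant of the polymatroid bound. Starting the maximum at `0#` makes it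
  -- nonnegative whatever signs `f` takes.
  upper-bound : ∀ {A : Set} (f : A → ℝ) (xs : List A) →
                ∃[ t ] (0# ≤ᵥ t × (∀ {x} → x ∈ xs → f x ≤ᵥ t))
  upper-bound f [] = 0# , ≤ᵥ-refl , λ ()
  upper-bound f (x ∷ xs) with upper-bound f xs
  ... | t , 0≤t , xs≤t with total (f x) t
  ...   | inj₁ x≤t = t , 0≤t , λ { (here refl) → x≤t ; (there x∈) → xs≤t x∈ }
  ...   | inj₂ t≤x = f x , ≤ᵥ-trans 0≤t t≤x ,
    λ { (here refl) → ≤ᵥ-refl ; (there x∈) → ≤ᵥ-trans (xs≤t x∈) t≤x }

-- Minimum bases and the cost of relative complements.

module MinimumBases (L : FiniteModularComplementedLattice) (V : OrderedAbelianGroup)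
    (f : FiniteModularComplementedLattice.Carrier L → OrderedAbelianGroup.Carrier V)
    (f-nonneg : ∀ x → Setting.IsAtom L V x →
      OrderedAbelianGroup._≤_ V (OrderedAbelianGroup.0# V) (f x))
    (h : FiniteModularComplementedLattice.Carrier L → ℕ)
    (isHeight : Setting.IsHeightFunction L V h)
    (μ : FiniteModularComplementedLattice.Carrier L → OrderedAbelianGroup.Carrier V)
    (isMu : Setting.IsMuF L V h f μ) where
  open FiniteModularComplementedLattice L
    renaming (Carrier to El; _≤_ to infix 4 _⊑_; _∧_ to infix 7 _∧_; _∨_ to infix 6 _∨_)
  open OrderedAbelianGroup V
    renaming (Carrier to ℝ; _≤_ to infix 4 _≤ᵥ_)
  open Setting L V
  open LatticeFacts L
  open Heights L V h isHeight
  open OrderedGroupFacts V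

  Σf-nonneg : ∀ {β} → All IsAtom β → 0# ≤ᵥ Σf f β
  Σf-nonneg [] = ≤ᵥ-refl
  Σf-nonneg (a ∷ as) = +-nonneg (f-nonneg _ a) (Σf-nonneg as)

  Σf-++ : ∀ β γ → Σf f (β ++ γ) ≡ Σf f β + Σf f γ
  Σf-++ [] γ = sym (+-identityˡ _)
  Σf-++ (x ∷ β) γ = trans (cong (f x +_) (Σf-++ β γ)) (sym (+-assoc _ _ _))

  ⊑⋁ : ∀ {x β} → x ∈ β → x ⊑ ⋁ β
  ⊑⋁ {β = y ∷ β} (here refl) = x≤x∨y y (⋁ β)
  ⊑⋁ {β = y ∷ β} (there x∈β) = ⊑-trans (⊑⋁ x∈β) (y≤x∨y y (⋁ β))

  ⋁-++ : ∀ β γ → ⋁ (β ++ γ) ≡ ⋁ β ∨ ⋁ γ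
  ⋁-++ [] γ = ⊑-antisym (y≤x∨y _ _) (∨-least (minimum _) ⊑-refl)
  ⋁-++ (x ∷ β) γ rewrite ⋁-++ β γ = ⊑-antisym
    (∨-least (⊑-trans (x≤x∨y _ _) (x≤x∨y _ _))
      (∨-least (⊑-trans (y≤x∨y _ _) (x≤x∨y _ _)) (y≤x∨y _ _)))
    (∨-least (∨-least (x≤x∨y _ _) (⊑-trans (x≤x∨y _ _) (y≤x∨y _ _)))
      (⊑-trans (y≤x∨y _ _) (y≤x∨y _ _)))

  minimum-basis : ∀ X → ∃[ β ] (All IsAtom β × length β ≡ h X × ⋁ β ≡ X × Σf f β ≡ μ X)
  minimum-basis X with ≡𝟎? X
  ... | yes refl = [] , [] , sym h-𝟎 , refl , sym (proj₁ isMu)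
  ... | no X≢𝟎 with proj₁ (proj₂ isMu X X≢𝟎)
  ...   | β , _ , atoms , len , join , weight = β , All.map proj₁ atoms , len , join , weight

  μ-nonneg : ∀ X → 0# ≤ᵥ μ X
  μ-nonneg X with minimum-basis X
  ... | β , atoms , _ , _ , weight = subst (0# ≤ᵥ_) weight (Σf-nonneg atoms)

  μ-⋁≤Σf : ∀ {γ} → Unique γ → All IsAtom γ → length γ ≡ h (⋁ γ) → μ (⋁ γ) ≤ᵥ Σf f γ
  μ-⋁≤Σf {γ} unique atoms len with ≡𝟎? (⋁ γ)
  ... | yes eq = subst (_≤ᵥ Σf f γ) (sym (trans (cong μ eq) (proj₁ isMu))) (Σf-nonneg atoms)
  ... | no γ≢𝟎 = proj₂ (proj₂ isMu (⋁ γ) γ≢𝟎) _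
    (γ , unique , All.zip (atoms , All.tabulate ⊑⋁) , len , refl , refl)

  IndependentFrom : El → List El → Set
  IndependentFrom K γ =
    Unique γ × All IsAtom γ × length γ ≡ h (⋁ γ) × ⋁ γ ∧ K ≡ 𝟎

  -- An atom `x` is kept only if it misses `⋁ γ ∨ K`, where `γ` is what was kept from the tail; it
  -- then raises the height by exactly one. Otherwise it lies below that join, so dropping it
  -- preserves the span and, as `f x` is nonnegative, does not raise the weight.
  greedy : ∀ K {β} → All IsAtom β →
           ∃[ γ ] (IndependentFrom K γ × ⋁ γ ∨ K ≡ ⋁ β ∨ K × Σf f γ ≤ᵥ Σf f β)
  greedy K [] = [] , ([] , [] , sym h-𝟎 , ⊑𝟎⇒≡𝟎 (x∧y≤x 𝟎 K)) , refl , ≤ᵥ-refl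
  greedy K {x ∷ β} (x-atom ∷ atoms) with greedy K atoms
  ... | γ , (unique , γ-atoms , len , disjoint) , spans , weight
    with atom-∧ x-atom (⋁ γ ∨ K)
  ...   | inj₂ x⊑ = γ , (unique , γ-atoms , len , disjoint) ,
    ⊑-antisym
      (⊑-trans (⊑-reflexive spans)
        (∨-least (⊑-trans (y≤x∨y _ _) (x≤x∨y _ K)) (y≤x∨y _ K)))
      (∨-least
        (∨-least x⊑ (⊑-trans (x≤x∨y _ K) (⊑-reflexive (sym spans)))) (y≤x∨y _ K)) ,
    ≤ᵥ-trans weight (≤-+ˡ (f-nonneg x x-atom))
  ...   | inj₁ x∧≡𝟎 = x ∷ γ ,
    ( All.tabulate (λ y∈γ x≡y → atom-disjoint⇒⋢ x-atom x∧γ≡𝟎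
        (⊑-trans (⊑-reflexive x≡y) (⊑⋁ y∈γ))) ∷ unique
    , x-atom ∷ γ-atoms
    , trans (cong suc len) (sym (h-atom-∨ x-atom x∧γ≡𝟎))
    , ∨∧≡𝟎 x (⋁ γ) K disjoint x∧≡𝟎 ) ,
    ⊑-antisym (join-mono spans) (join-mono (sym spans)) ,
    +-mono ≤ᵥ-refl weight
    where
    x∧γ≡𝟎 : x ∧ ⋁ γ ≡ 𝟎
    x∧γ≡𝟎 = ∧≡𝟎-mono ⊑-refl (x≤x∨y _ K) x∧≡𝟎
    join-mono : ∀ {a b} → a ∨ K ≡ b ∨ K → (x ∨ a) ∨ K ⊑ (x ∨ b) ∨ K
    join-mono {a} {b} eq = ∨-least
      (∨-least (⊑-trans (x≤x∨y _ _) (x≤x∨y _ K))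
        (⊑-trans (x≤x∨y a K) (⊑-trans (⊑-reflexive eq)
          (∨-least (⊑-trans (y≤x∨y x b) (x≤x∨y _ K)) (y≤x∨y _ K)))))
      (y≤x∨y _ K)

  concat-bases : ∀ Ys → ∃[ β ] (All IsAtom β × ⋁ β ≡ ⋁ Ys × Σf f β ≡ Σf μ Ys)
  concat-bases [] = [] , [] , refl , refl
  concat-bases (Y ∷ Ys) with minimum-basis Y | concat-bases Ys
  ... | β , β-atoms , _ , ⋁β , Σβ | γ , γ-atoms , ⋁γ , Σγ =
    β ++ γ , ++⁺ β-atoms γ-atoms ,
    trans (⋁-++ β γ) (cong₂ _∨_ ⋁β ⋁γ) ,
    trans (Σf-++ β γ) (cong₂ _+_ Σβ Σγ)

  cheap-relCompl : ∀ {K X} Ys → K ⊑ X → All (_⊑ X) Ys → X ⊑ ⋁ Ys ∨ K →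
                   ∃[ D ] (RelCompl K X D × μ D ≤ᵥ Σf μ Ys)
  cheap-relCompl {K} {X} Ys K⊑X Ys⊑X X⊑ with concat-bases Ys
  ... | β , atoms , ⋁β , Σβ with greedy K atoms
  ...   | γ , (unique , γ-atoms , len , disjoint) , spans , weight =
    -- The join of the thinned list is the relative complement, and the weight of that list bounds
    -- its `μ`.
    ⋁ γ ,
    ( disjoint
    , trans spans (trans (cong (_∨ K) ⋁β) (⊑-antisym (∨-least (⋁⊑ Ys⊑X) K⊑X) X⊑)) ) ,
    ≤ᵥ-trans (μ-⋁≤Σf unique γ-atoms len) (≤ᵥ-trans weight (≤ᵥ-reflexive Σβ))
    where
    ⋁⊑ : ∀ {Zs} → All (_⊑ X) Zs → ⋁ Zs ⊑ X
    ⋁⊑ [] = minimum X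
    ⋁⊑ (Z⊑ ∷ Zs⊑) = ∨-least Z⊑ (⋁⊑ Zs⊑)

  Σf≤length· : ∀ {t} → (∀ x → f x ≤ᵥ t) → ∀ β → Σf f β ≤ᵥ (length β · t)
  Σf≤length· f≤t [] = ≤ᵥ-refl
  Σf≤length· f≤t (x ∷ β) = +-mono (f≤t x) (Σf≤length· f≤t β)

  μ≤h· : ∀ {t} → (∀ x → f x ≤ᵥ t) → ∀ X → μ X ≤ᵥ (h X · t)
  μ≤h· {t} f≤t X with minimum-basis X
  ... | β , _ , len , _ , weight =
    subst₂ (λ w n → w ≤ᵥ (n · t)) weight len (Σf≤length· f≤t β)

  -- With `C` from quasi-modularity, take `R = X ∧ C`; modularity turns `C ∨ Y ≡ 𝟏` into the
  -- spanning of `X` by `Y` and `R`.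
  quasi-split : ∀ {X Y} → QuasiModularOn μ X → Y ⊑ X →
                ∃[ R ] (R ⊑ X × X ⊑ Y ∨ R × μ X ≡ μ Y + μ R)
  quasi-split {X} {Y} quasi Y⊑X with quasi Y Y⊑X
  ... | C , (_ , C∨Y≡𝟏) , split = X ∧ C , x∧y≤x X C , X⊑ , split
    where
    X⊑ : X ⊑ Y ∨ (X ∧ C)
    X⊑ = ⊑-trans
      (∧-greatest
        (⊑-trans (maximum X) (⊑-trans (⊑-reflexive (sym C∨Y≡𝟏))
          (∨-least (y≤x∨y Y C) (x≤x∨y Y C))))
        ⊑-refl)
      (⊑-trans (⊑-reflexive (sym (modular Y C X Y⊑X)))
        (∨-least (x≤x∨y Y _)
          (⊑-trans (∧-greatest (x∧y≤y C X) (x∧y≤x C X)) (y≤x∨y Y _))))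

  quasi-mono : ∀ {X Y} → QuasiModularOn μ X → Y ⊑ X → μ Y ≤ᵥ μ X
  quasi-mono quasi Y⊑X with quasi-split quasi Y⊑X
  ... | R , _ , _ , split = subst (_ ≤ᵥ_) (sym split) (≤-+ʳ (μ-nonneg R))

  -- Since `D ⊑ X`, it misses `z` itself and extends to a complement `C` of `z` in the whole
  -- lattice. This adds nothing inside `X`: by modularity `X ∧ C = D ∨ ((z ∧ X) ∧ C) = D`.
  realize : ∀ {z X D} → RelCompl (z ∧ X) X D → ∃[ C ] (ComplRel z X C × X ∧ C ≡ D)
  realize {z} {X} {D} D-compl@(disjoint , spans)
    with extend (maximum D) (maximum z)
           (⊑𝟎⇒≡𝟎 (⊑-trans
             (∧-greatest (x∧y≤x D z)
               (∧-greatest (x∧y≤y D z) (⊑-trans (x∧y≤x D z) (RelCompl-⊑ D-compl))))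
             (⊑-reflexive disjoint)))
  ... | C , D⊑C , C∧z≡𝟎 , C∨z≡𝟏 = C ,
    ( (C∧z≡𝟎 , C∨z≡𝟏)
    , ⊑-antisym (∨-least (x∧y≤y C X) (x∧y≤y z X))
        (⊑-trans (⊑-reflexive (sym spans))
          (∨-least (⊑-trans (∧-greatest D⊑C D⊑X) (x≤x∨y _ _)) (y≤x∨y _ _))) ) ,
    ⊑-antisym X∧C⊑D (∧-greatest D⊑X D⊑C)
    where
    D⊑X : D ⊑ X
    D⊑X = RelCompl-⊑ D-compl
    X∧C⊑D : X ∧ C ⊑ D
    X∧C⊑D = ⊑-trans
      (∧-greatest (⊑-trans (x∧y≤x X C) (⊑-reflexive (sym spans))) (x∧y≤y X C))
      (⊑-trans (⊑-reflexive (sym (modular D (z ∧ X) C D⊑C)))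
        (∨-least ⊑-refl
          (⊑-trans
            (∧-greatest (x∧y≤y _ C) (⊑-trans (x∧y≤x _ C) (x∧y≤x z X)))
            (⊑-trans (⊑-reflexive C∧z≡𝟎) (minimum D)))))

  -- Bounds, monotonicity and submodularity of `ρ`.

  module Rho (𝒵 : SubLattice) (λ' : SubLattice.Z 𝒵 → ℝ)
      (λ-nonneg : ∀ z → 0# ≤ᵥ λ' z)
      (ρ : El → ℝ) (isRho : IsRho 𝒵 h μ λ' ρ)
      (z1 : Z1 𝒵 h μ λ' ρ) (z2 : Z2 𝒵 h μ λ') (z5 : Z5 𝒵 h μ λ') where
    open SubLattice 𝒵

    ρ≤ : ∀ {z X D} → RelCompl (ι z ∧ X) X D → ρ X ≤ᵥ (λ' z + μ D)
    ρ≤ {z} {X} D-compl with realize D-compl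
    ... | C , C-compl , refl = proj₂ (isRho X) _ (z , C , C-compl , refl)

    -- (Z1) covers every admissible complement, hence via `realize` every relative complement `D`.
    -- So `D` may later be chosen above a prescribed element.
    ρ-attained : ∀ X → ∃[ z ] (∀ {D} → RelCompl (ι z ∧ X) X D →
                   λ' z + μ D ≡ ρ X × QuasiModularOn μ D)
    ρ-attained X with z1 X
    ... | z , _ , attains , quasi = z , at
      where
      at : ∀ {D} → RelCompl (ι z ∧ X) X D → λ' z + μ D ≡ ρ X × QuasiModularOn μ D
      at D-compl with realize D-compl
      ... | C , C-compl , refl = attains C C-compl , quasi C C-compl

    ρ-nonneg : ∀ X → 0# ≤ᵥ ρ X
    ρ-nonneg X with proj₁ (isRho X)
    ... | z , C , _ , eq = subst (0# ≤ᵥ_) eq (+-nonneg (λ-nonneg z) (μ-nonneg (X ∧ C)))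

    -- Compare with `0Z`, which costs nothing by (Z5). As `ι 0Z` may differ from `𝟎`, the candidate
    -- is a relative complement of `ι 0Z ∧ X`, priced from the one-entry list `X`.
    ρ≤μ : ∀ X → ρ X ≤ᵥ μ X
    ρ≤μ X with cheap-relCompl (X ∷ []) (x∧y≤y (ι 0Z) X) (⊑-refl ∷ [])
                 (⊑-trans (x≤x∨y X _) (x≤x∨y _ _))
    ... | D , D-compl , μD≤ = ≤ᵥ-trans (ρ≤ D-compl)
      (subst₂ _≤ᵥ_ (trans (sym (+-identityˡ _)) (cong (_+ μ D) (sym z5))) (+-identityʳ _) μD≤)

    -- Take `z` optimal for `B`. A relative complement `D` of `ι z ∧ A` in `A` also misses
    -- `ι z ∧ B`, so it extends to some `D′` admissible for `B`. Quasi-modularity on `D′` gives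
    -- `μ D ≤ μ D′`.
    ρ-mono : ∀ A B → A ⊑ B → ρ A ≤ᵥ ρ B
    ρ-mono A B A⊑B with ρ-attained B
    ... | z , at-B with relCompl (x∧y≤y (ι z) A)
    ...   | D , D-compl with extend (⊑-trans (RelCompl-⊑ D-compl) A⊑B) (x∧y≤y (ι z) B)
              (⊑𝟎⇒≡𝟎 (⊑-trans
                (∧-greatest (x∧y≤x D _) (∧-greatest
                  (⊑-trans (x∧y≤y D _) (x∧y≤x (ι z) B))
                  (⊑-trans (x∧y≤x D _) (RelCompl-⊑ D-compl))))
                (⊑-reflexive (proj₁ D-compl))))
    ...     | D′ , D⊑D′ , D′-compl with at-B D′-compl
    ...       | eq , quasi = ≤ᵥ-trans (ρ≤ D-compl)
      (subst (_ ≤ᵥ_) eq (+-mono ≤ᵥ-refl (quasi-mono quasi D⊑D′)))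

    ρ-submodular : ∀ A B → (ρ (A ∨ B) + ρ (A ∧ B)) ≤ᵥ (ρ A + ρ B)
    ρ-submodular A B
      with ρ-attained A | ρ-attained B
    ... | u , at-A | v , at-B
      with relCompl (x∧y≤x (A ∧ B) (ι u))
         | relCompl (x∧y≤x ((A ∧ B) ∧ ι u) (ι v))
         | relCompl (x∧y≤y (ι (u ∧Z v)) (((A ∧ B) ∧ ι u) ∧ ι v))
    ... | Q₁ , Q₁-compl | Q₂ , Q₂-compl | P , P-compl
      -- `Q₁` lies below `A ∧ B` and misses its meet with `ι u`, so it misses `ι u ∧ A`.
      with extend {K = ι u ∧ A} {D = Q₁}
             (⊑-trans (RelCompl-⊑ Q₁-compl) (x∧y≤x A B)) (x∧y≤y (ι u) A)
             (⊑𝟎⇒≡𝟎 (⊑-trans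
               (∧-greatest (x∧y≤x Q₁ _) (∧-greatest
                 (⊑-trans (x∧y≤x Q₁ _) (RelCompl-⊑ Q₁-compl))
                 (⊑-trans (x∧y≤y Q₁ _) (x∧y≤x (ι u) A))))
               (⊑-reflexive (proj₁ Q₁-compl))))
         | extend {K = ι v ∧ B} {D = Q₂}
             (⊑-trans (RelCompl-⊑ Q₂-compl) (⊑-trans (x∧y≤x _ (ι u)) (x∧y≤y A B)))
             (x∧y≤y (ι v) B)
             (⊑𝟎⇒≡𝟎 (⊑-trans
               (∧-greatest (x∧y≤x Q₂ _) (∧-greatest
                 (⊑-trans (x∧y≤x Q₂ _) (RelCompl-⊑ Q₂-compl))
                 (⊑-trans (x∧y≤y Q₂ _) (x∧y≤x (ι v) B))))
               (⊑-reflexive (proj₁ Q₂-compl))))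
         -- (Z2) speaks of complements in the whole lattice, so `P` is presented as a meet with such
         -- a `C`.
         | realize P-compl
    ... | D₁ , Q₁⊑D₁ , D₁-compl | D₂ , Q₂⊑D₂ , D₂-compl | C , (C-compl , _) , C≡P
      with at-A D₁-compl | at-B D₂-compl
    ... | ρA , quasi₁ | ρB , quasi₂
      with quasi-split quasi₁ Q₁⊑D₁ | quasi-split quasi₂ Q₂⊑D₂
    ... | R₁ , R₁⊑D₁ , D₁⊑ , μD₁ | R₂ , R₂⊑D₂ , D₂⊑ , μD₂ = conclusion
      where
      w j : Z
      w = u ∧Z v
      j = u ∨Z v
      I U K S : El
      I = A ∧ B
      U = A ∨ B
      K = ι j ∧ U
      -- `cheap-relCompl` will require `U ⊑ S` and `I ⊑ T`.
      S = ⋁ (R₁ ∷ R₂ ∷ []) ∨ K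
      T : El
      T = ⋁ (Q₁ ∷ Q₂ ∷ P ∷ []) ∨ (ι w ∧ I)

      Q₁⊑I : Q₁ ⊑ I
      Q₁⊑I = RelCompl-⊑ Q₁-compl
      Q₂⊑I∧u : Q₂ ⊑ I ∧ ι u
      Q₂⊑I∧u = RelCompl-⊑ Q₂-compl
      P⊑M : P ⊑ (I ∧ ι u) ∧ ι v
      P⊑M = RelCompl-⊑ P-compl

      -- The splitting of `I` is undone from the bottom up, each stage adding one complement to the
      -- stage before.
      M⊑T : (I ∧ ι u) ∧ ι v ⊑ T
      M⊑T = ⊑-trans (⊑-reflexive (sym (proj₂ P-compl)))
        (∨-least
          (⊑-trans (⊑⋁ {β = Q₁ ∷ Q₂ ∷ P ∷ []} (there (there (here refl)))) (x≤x∨y _ _))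
          (⊑-trans
            (∧-greatest (x∧y≤x _ _)
              (⊑-trans (x∧y≤y _ _) (⊑-trans (x∧y≤x _ _) (x∧y≤x _ _))))
            (y≤x∨y _ _)))
      I∧u⊑T : I ∧ ι u ⊑ T
      I∧u⊑T = ⊑-trans (⊑-reflexive (sym (proj₂ Q₂-compl)))
        (∨-least (⊑-trans (⊑⋁ {β = Q₁ ∷ Q₂ ∷ P ∷ []} (there (here refl))) (x≤x∨y _ _)) M⊑T)
      I⊑T : I ⊑ T
      I⊑T = ⊑-trans (⊑-reflexive (sym (proj₂ Q₁-compl)))
        (∨-least (⊑-trans (⊑⋁ {β = Q₁ ∷ Q₂ ∷ P ∷ []} (here refl)) (x≤x∨y _ _)) I∧u⊑T)

      A∧u⊑S : ∀ {a} → a ⊑ A → a ⊑ ι u → a ⊑ S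
      A∧u⊑S a⊑A a⊑u = ⊑-trans
        (∧-greatest (⊑-trans a⊑u (∨Z-upper₁ u v)) (⊑-trans a⊑A (x≤x∨y A B)))
        (y≤x∨y _ K)
      -- `B` comes before `A`: `Q₂` lies below `A` and `ι u`, hence below `K`, whereas `Q₁` reaches
      -- `S` only through `B`.
      B⊑S : B ⊑ S
      B⊑S = ⊑-trans (⊑-reflexive (sym (proj₂ D₂-compl))) (∨-least
        (⊑-trans D₂⊑ (∨-least
          (A∧u⊑S (⊑-trans Q₂⊑I∧u (⊑-trans (x∧y≤x _ _) (x∧y≤x A B)))
                 (⊑-trans Q₂⊑I∧u (x∧y≤y _ _)))
          (⊑-trans (⊑⋁ {β = R₁ ∷ R₂ ∷ []} (there (here refl))) (x≤x∨y _ K))))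
        (⊑-trans
          (∧-greatest (⊑-trans (x∧y≤x (ι v) B) (∨Z-upper₂ u v))
                      (⊑-trans (x∧y≤y (ι v) B) (y≤x∨y A B)))
          (y≤x∨y _ K)))
      A⊑S : A ⊑ S
      A⊑S = ⊑-trans (⊑-reflexive (sym (proj₂ D₁-compl))) (∨-least
        (⊑-trans D₁⊑ (∨-least
          (⊑-trans Q₁⊑I (⊑-trans (x∧y≤y A B) B⊑S))
          (⊑-trans (⊑⋁ {β = R₁ ∷ R₂ ∷ []} (here refl)) (x≤x∨y _ K))))
        (A∧u⊑S (x∧y≤y _ _) (x∧y≤x _ _)))

      ρI≤ : ρ I ≤ᵥ (λ' w + Σf μ (Q₁ ∷ Q₂ ∷ P ∷ []))
      ρI≤ with cheap-relCompl (Q₁ ∷ Q₂ ∷ P ∷ []) (x∧y≤y (ι w) I)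
                 (Q₁⊑I ∷ ⊑-trans Q₂⊑I∧u (x∧y≤x _ _)
                   ∷ ⊑-trans P⊑M (⊑-trans (x∧y≤x _ _) (x∧y≤x _ _)) ∷ [])
                 I⊑T
      ... | D , D-compl , μD≤ = ≤ᵥ-trans (ρ≤ D-compl) (+-mono ≤ᵥ-refl μD≤)

      ρU≤ : ρ U ≤ᵥ (λ' j + Σf μ (R₁ ∷ R₂ ∷ []))
      ρU≤ with cheap-relCompl (R₁ ∷ R₂ ∷ []) (x∧y≤y (ι j) U)
                 (⊑-trans R₁⊑D₁ (⊑-trans (RelCompl-⊑ D₁-compl) (x≤x∨y A B))
                   ∷ ⊑-trans R₂⊑D₂ (⊑-trans (RelCompl-⊑ D₂-compl) (y≤x∨y A B)) ∷ [])
                 (∨-least A⊑S B⊑S)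
      ... | E , E-compl , μE≤ = ≤ᵥ-trans (ρ≤ E-compl) (+-mono ≤ᵥ-refl μE≤)

      λ≤ : (λ' w + λ' j + μ P) ≤ᵥ (λ' u + λ' v)
      -- Taking `I` for the free element of (Z2) turns its last term into `μ P`.
      λ≤ = subst (λ y → (λ' w + λ' j + μ y) ≤ᵥ (λ' u + λ' v)) C≡P (z2 u v C C-compl I)

      regroup : (λ' w + λ' j + μ P) + ((μ Q₁ + μ R₁) + (μ Q₂ + μ R₂))
              ≡ (λ' j + Σf μ (R₁ ∷ R₂ ∷ [])) + (λ' w + Σf μ (Q₁ ∷ Q₂ ∷ P ∷ []))
      regroup = solve 7 (λ a b p q₁ r₁ q₂ r₂ →
          ((a ⊕ b) ⊕ p) ⊕ ((q₁ ⊕ r₁) ⊕ (q₂ ⊕ r₂))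
          ⊜ (b ⊕ (r₁ ⊕ (r₂ ⊕ id))) ⊕ (a ⊕ (q₁ ⊕ (q₂ ⊕ (p ⊕ id)))))
        refl (λ' w) (λ' j) (μ P) (μ Q₁) (μ R₁) (μ Q₂) (μ R₂)

      ρA+ρB : (λ' u + λ' v) + ((μ Q₁ + μ R₁) + (μ Q₂ + μ R₂)) ≡ ρ A + ρ B
      ρA+ρB = trans
        (cong₂ (λ x y → (λ' u + λ' v) + (x + y)) (sym μD₁) (sym μD₂))
        (trans
          (solve 4 (λ a b c d → (a ⊕ b) ⊕ (c ⊕ d) ⊜ (a ⊕ c) ⊕ (b ⊕ d)) refl
            (λ' u) (λ' v) (μ D₁) (μ D₂))
          (cong₂ _+_ ρA ρB))

      conclusion : (ρ U + ρ I) ≤ᵥ (ρ A + ρ B)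
      conclusion = ≤ᵥ-trans (+-mono ρU≤ ρI≤)
        (subst₂ _≤ᵥ_ regroup ρA+ρB (+-mono λ≤ ≤ᵥ-refl))

    polymatroid : IsPolymatroid h ρ
    polymatroid with upper-bound f elements
    ... | t , 0≤t , f≤t = t , 0≤t ,
      (λ A → ρ-nonneg A , ≤ᵥ-trans (ρ≤μ A) (μ≤h· (f≤t ∘ complete) A)) ,
      ρ-mono ,
      λ A B → +≤+⇒-≤- (ρ (A ∨ B)) (ρ B) (ρ A) (ρ (A ∧ B)) (ρ-submodular A B)

open FiniteModularComplementedLattice using (Carrier)
open OrderedAbelianGroup using (0#) renaming (Carrier to Val; _≤_ to leq)
open Setting

theorem5p10 : (L : FiniteModularComplementedLattice) (V : OrderedAbelianGroup) →
    (𝒵 : SubLattice L V) →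
    (λ' : SubLattice.Z 𝒵 → Val V) → (∀ z → leq V (0# V) (λ' z)) →
    (f : Carrier L → Val V) → (∀ x → IsAtom L V x → leq V (0# V) (f x)) →
    (h : Carrier L → ℕ) → IsHeightFunction L V h →
    (μ : Carrier L → Val V) → IsMuF L V h f μ →
    (ρ : Carrier L → Val V) → IsRho L V 𝒵 h μ λ' ρ →
    Z1 L V 𝒵 h μ λ' ρ → Z2 L V 𝒵 h μ λ' → Z5 L V 𝒵 h μ λ' →
    IsPolymatroid L V h ρ
theorem5p10 L V 𝒵 λ' λ-nonneg f f-nonneg h isHeight μ isMu ρ isRho z1 z2 z5 =
  MinimumBases.Rho.polymatroid L V f f-nonneg h isHeight μ isMu
    𝒵 λ' λ-nonneg ρ isRho z1 z2 z5
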